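{- Regular Unconnectivity in Automatic Graphs is $\mathsf{RE}$-hard.
   Context: An automatic presentation $\mathcal{G}$ of a directed graph over a finite alphabet $\Sigma$ consists of a regular language $\mathrm{dom}(\mathcal{G})\subseteq\Sigma^*$ and a binary relation $E^{\mathcal{G}}\subseteq(\Sigma^*)^2$ that is automatic (the set of convolutions $u\otimes v$, obtained by writing $u,v$ left-aligned on two tracks padded with a fresh symbol, is regular); it represents the directed graph $\mathbb{G}$ with vertex set $\mathrm{dom}(\mathcal{G})$ and edge relation $E^{\mathcal{G}}$. Regular Unconnectivity in Automatic Graphs: given such $\mathcal{G}$ and two words $s,t\in\mathrm{dom}(\mathcal{G})$, decide whether there is a regular language $L\subseteq\Sigma^*$ such that $s\in L$, $t\notin L$, and $L$ is a union of connected components (of the underlying undirected graph) of $\mathbb{G}$. -}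

module Defs where

open import Data.Nat using (ℕ; zero; suc)
open import Data.Fin using (Fin; zero; suc)
open import Data.Bool using (Bool; true; false; T)
open import Data.List using (List; []; _∷_; foldl)
open import Data.Maybe using (Maybe; just; nothing; _>>=_)
open import Data.Product using (Σ; ∃; _×_; _,_)
open import Relation.Nullary using (¬_)
open import Relation.Binary.PropositionalEquality using (_≡_)
open import Function.Bundles using (_⇔_)

record DFA (A : Set) : Set where
  field
    n     : ℕ
    δ     : Fin (suc n) → A → Fin (suc n)
    final : Fin (suc n) → Bool

  run : Fin (suc n) → List A → Fin (suc n)
  run = foldl δ

  accepts : List A → Set
  accepts w = T (final (run zero w))

open DFA public using (accepts)

-- Words over the finite alphabet Σ = Fin k, and convolution u ⊗ v over
-- the padded alphabet (Maybe Σ × Maybe Σ); `nothing` is the fresh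
-- padding symbol.

Word : ℕ → Set
Word k = List (Fin k)

conv : ∀ {k} → Word k → Word k → List (Maybe (Fin k) × Maybe (Fin k))
conv []       []       = []
conv []       (b ∷ v)  = (nothing , just b) ∷ conv [] v
conv (a ∷ u)  []       = (just a , nothing) ∷ conv u []
conv (a ∷ u)  (b ∷ v)  = (just a , just b) ∷ conv u v

record AutoPres (k : ℕ) : Set where
  field
    domA  : DFA (Fin k)
    edgeA : DFA (Maybe (Fin k) × Maybe (Fin k))

  Dom : Word k → Set
  Dom w = accepts domA w

  Edge : Word k → Word k → Set
  Edge u v = Dom u × Dom v × accepts edgeA (conv u v)

record Instance : Set where
  field
    k   : ℕ
    G   : AutoPres k
    s   : Word k
    t   : Word k
    s∈  : AutoPres.Dom G s
    t∈  : AutoPres.Dom G t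

-- L (given by a DFA, hence regular) is a union of connected components of
-- the underlying undirected graph: L ⊆ dom and L is closed under edges
-- in both directions.
UnionOfComponents : ∀ {k} → AutoPres k → DFA (Fin k) → Set
UnionOfComponents {k} G D =
  ((w : Word k) → accepts D w → AutoPres.Dom G w) ×
  ((u v : Word k) → AutoPres.Edge G u v → (accepts D u ⇔ accepts D v))

RegUnconn : Instance → Set
RegUnconn I =
  Σ (DFA (Fin k)) λ D → accepts D s × ¬ accepts D t × UnionOfComponents G D
  where open Instance I

-- Deterministic Turing machines (two-way infinite tape, blank = zero,
-- start state zero, empty input). A machine halts when δ is undefined.

data Move : Set where
  L R : Move

record TM : Set where
  field
    q : ℕ
    g : ℕ
    δ : Fin (suc q) → Fin (suc g) → Maybe (Fin (suc q) × Fin (suc g) × Move)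

record Config (M : TM) : Set where
  constructor config
  field
    state : Fin (suc (TM.q M))
    left  : List (Fin (suc (TM.g M)))   -- reversed: head is adjacent cell
    cur   : Fin (suc (TM.g M))
    right : List (Fin (suc (TM.g M)))

module _ (M : TM) where
  private
    Sym = Fin (suc (TM.g M))
    hd : List Sym → Sym
    hd []      = zero
    hd (x ∷ _) = x
    tl : List Sym → List Sym
    tl []       = []
    tl (_ ∷ xs) = xs

  step : Config M → Maybe (Config M)
  step (config st l a r) with TM.δ M st a
  ... | nothing            = nothing
  ... | just (st' , b , L) = just (config st' (tl l) (hd l) (b ∷ r))
  ... | just (st' , b , R) = just (config st' (b ∷ l) (hd r) (tl r))

  iterate : ℕ → Config M → Maybe (Config M)
  iterate zero    c = just c
  iterate (suc n) c = step c >>= iterate n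

  initial : Config M
  initial = config zero [] zero []

  Halts : Set
  Halts = ∃ λ n → iterate n initial ≡ nothing

{-# OPTIONS --safe #-}
-- The words of the graph display a configuration of M (tape cells around a head letter, the
-- initial one being h₀) followed by clock letters a. A cellular automaton step simulates one step
-- of M while widening the display and appending one clock, and the graph joins every word to its
-- image under this step; since output letter i depends only on input letters i - 2, i - 1 and i,
-- this relation is automatic. Ladder edges join h₀ a^(d+1) to h₀ a^(d+2); s = h₀ and t = h₀ a.
-- If M halts after n steps, the words that reach the halting display exactly when their clock
-- suffix says they should have bounded length and form a union of components containing s but
-- not t. If M runs forever and a DFA with N states accepts the component of s, it accepts the
-- display reached after N steps followed by N clocks; pumping the clocks yields a word with
-- N + d + 1 clocks, which evolved from h₀ a^(d+1) and is therefore connected to t.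
module Submission where

open import Defs
open import Data.Product using (Σ)
open import Function.Bundles using (_⇔_)

open import Data.Bool using (Bool; true; false; T; not; _∧_; _∨_; if_then_else_)
open import Data.Bool.ListAction using (all)
open import Data.Bool.Properties using (T-∨; T-∧; ∧-assoc; ∧-identityʳ)
open import Data.Empty using (⊥-elim)
open import Data.Fin using (Fin; zero; suc; toℕ; combine; remQuot; _≟_)
open import Data.Fin.Patterns using (0F; 1F; 2F; 3F)
open import Data.Fin.Properties using (+↔⊎; *↔×; 2↔Bool; pigeonhole; toℕ<n; remQuot-combine)
open import Data.List using (List; []; _∷_; _++_; _∷ʳ_; foldl; length; replicate; map)
open import Data.List.Membership.Propositional using (_∈_)
open import Data.List.Membership.Propositional.Properties using (∈-++⁺ʳ; ∈-map⁺)
open import Data.List.Properties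
  using (≡-dec; length-++; length-map; length-replicate; ++-assoc; ++-identityʳ; ∷ʳ-++; ∷-injectiveˡ; ∷-injectiveʳ;
         foldl-++; map-++; map-replicate)
open import Data.List.Relation.Unary.All using (All; []; _∷_)
import Data.List.Relation.Unary.All as All
open import Data.List.Relation.Unary.All.Properties using (all⁺; all⁻; ++⁺; replicate⁺; map⁺)
open import Data.List.Relation.Unary.Any using (here)
open import Data.Maybe using (Maybe; just; nothing; _<∣>_; _>>=_) renaming (map to mapᴹ)
open import Data.Maybe.Properties using () renaming (≡-dec to ≡-decᴹ)
open import Data.Nat using (ℕ; zero; suc; _+_; _*_; _∸_; _≤_; _<_; z≤n; s≤s; _≤ᵇ_; _≤?_)
import Data.Nat as ℕ
open import Data.Nat.Properties
  using (≤ᵇ⇒≤; ≤⇒≤ᵇ; ≤-trans; ≤-refl; ≤-pred; <⇒≤; ≤∧≢⇒<; m≤m+n; m≤n⇒m≤1+n; m≤n⇒∃[o]m+o≡n;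
         +-mono-≤; +-suc; +-comm; +-assoc; +-identityʳ; +-∸-assoc; n∸n≡0; suc-injective; module ≤-Reasoning)
open import Data.Product using (∃-syntax; _×_; _,_; proj₁; proj₂)
open import Data.Product.Function.NonDependent.Propositional using (_×-↪_)
open import Data.Product.Properties using () renaming (≡-dec to ≡-dec×)
open import Data.Sum using (_⊎_; inj₁; inj₂)
open import Data.Sum.Function.Propositional using (_⊎-↪_; _⊎-⇔_)
open import Data.Unit using (⊤; tt)
open import Function using (_∘_; id)
open import Function.Bundles using (_↪_; mk↪; mk⇔; Equivalence; RightInverse)
open import Function.Construct.Composition using (_↪-∘_)
open import Function.Construct.Identity using (↪-id)
open import Function.Properties.Equivalence using (⇔-isEquivalence) renaming (trans to ⇔-trans; sym to ⇔-sym)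
open import Function.Properties.Inverse using (↔⇒↪; ↔-sym)
open import Relation.Binary.Construct.Closure.Equivalence using (EqClosure; gfold)
open import Relation.Binary.Construct.Closure.ReflexiveTransitive using (ε; _◅_; _◅◅_)
open import Relation.Binary.Construct.Closure.Symmetric using (fwd)
open import Relation.Binary.Definitions using (DecidableEquality)
open import Relation.Binary.PropositionalEquality using (_≡_; refl; sym; trans; cong; cong₂; subst; module ≡-Reasoning)
open import Relation.Nullary using (¬_; Dec; yes; no)
open import Relation.Nullary.Decidable using (⌊_⌋; toWitness; fromWitness; _×-dec_; T?)
open import Relation.Unary using (Decidable)

≡⇒⇔ : {A B : Set} → A ≡ B → A ⇔ B
≡⇒⇔ refl = mk⇔ id id

-- Finite codings

mk↪ₛ : {A B : Set} (to : A → B) (from : B → A) → (∀ a → from (to a) ≡ a) → A ↪ B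
mk↪ₛ to from from-to = mk↪ {to = to} {from = from} λ { refl → from-to _ }

module _ {S S′ : Set} {m n : ℕ} where

  _⊎-↪Fin_ : S ↪ Fin m → S′ ↪ Fin n → (S ⊎ S′) ↪ Fin (m + n)
  e ⊎-↪Fin f = ↔⇒↪ (↔-sym +↔⊎) ↪-∘ (e ⊎-↪ f)

  _×-↪Fin_ : S ↪ Fin m → S′ ↪ Fin n → (S × S′) ↪ Fin (m * n)
  e ×-↪Fin f = ↔⇒↪ (↔-sym *↔×) ↪-∘ (e ×-↪ f)

module _ {S : Set} {n : ℕ} where

  maybe-↪Fin : S ↪ Fin n → Maybe S ↪ Fin (suc n)
  maybe-↪Fin e = mk↪ₛ to′ from′ from-to′
    where
      open RightInverse e
      to′ : Maybe S → Fin (suc n)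
      to′ nothing  = zero
      to′ (just s) = suc (to s)
      from′ : Fin (suc n) → Maybe S
      from′ zero    = nothing
      from′ (suc i) = just (from i)
      from-to′ : ∀ s → from′ (to′ s) ≡ s
      from-to′ nothing  = refl
      from-to′ (just s) = cong just (strictlyInverseʳ s)

-- Automata with finitely coded states

record Automaton (A : Set) : Set₁ where
  field
    State     : Set
    start     : State
    next      : State → A → State
    accepting : State → Bool

  Accepts : List A → Set
  Accepts w = T (accepting (foldl next start w))

-- Distinct codes are needed only for the states satisfying an invariant of the reachable ones.
record FiniteCoding {A : Set} (M : Automaton A) : Set₁ where
  open Automaton M
  field
    size            : ℕ
    code            : State → Fin size
    decode          : Fin size → State
    Invariant       : State → Set
    invariant-start : Invariant start
    invariant-next  : ∀ s a → Invariant s → Invariant (next s a)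
    decode-code     : ∀ s → Invariant s → decode (code s) ≡ s

finiteCoding : ∀ {A n} {M : Automaton A} → Automaton.State M ↪ Fin n → FiniteCoding M
finiteCoding {n = n} e = record
  { size = n ; code = to ; decode = from
  ; Invariant = λ _ → ⊤ ; invariant-start = tt ; invariant-next = λ _ _ _ → tt
  ; decode-code = λ s _ → strictlyInverseʳ s }
  where open RightInverse e

module _ {A : Set} (M : Automaton A) (C : FiniteCoding M) where
  open Automaton M
  open FiniteCoding C

  -- The DFA keeps its state 0 for the start state, whose code need not be 0.
  stateOf : Fin (suc size) → State
  stateOf zero    = start
  stateOf (suc i) = decode i

  toDFA : DFA A
  toDFA = record
    { n = size
    ; δ = λ i a → suc (code (next (stateOf i) a))
    ; final = accepting ∘ stateOf }

  private
    stateOf-run : ∀ i s w → Invariant s → stateOf i ≡ s →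
                  stateOf (DFA.run toDFA i w) ≡ foldl next s w
    stateOf-run i s []      inv refl = refl
    stateOf-run i s (a ∷ w) inv refl =
      stateOf-run _ (next s a) w (invariant-next s a inv) (decode-code _ (invariant-next s a inv))

  accepts-toDFA : ∀ w → accepts toDFA w ⇔ Automaton.Accepts M w
  accepts-toDFA w = ≡⇒⇔ (cong (T ∘ accepting) (stateOf-run zero start w invariant-start refl))

module _ {A : Set} (M N : Automaton A) where
  private
    module M = Automaton M
    module N = Automaton N

  _∪ᴬ_ : Automaton A
  _∪ᴬ_ = record
    { State = M.State × N.State
    ; start = M.start , N.start
    ; next = λ (s , t) a → M.next s a , N.next t a
    ; accepting = λ (s , t) → M.accepting s ∨ N.accepting t }

  private
    run-∪ : ∀ s t w → foldl (Automaton.next _∪ᴬ_) (s , t) w ≡ (foldl M.next s w , foldl N.next t w)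
    run-∪ s t []      = refl
    run-∪ s t (a ∷ w) = run-∪ (M.next s a) (N.next t a) w

  Accepts-∪ : ∀ w → Automaton.Accepts _∪ᴬ_ w ⇔ (M.Accepts w ⊎ N.Accepts w)
  Accepts-∪ w rewrite run-∪ M.start N.start w = T-∨

module _ {A : Set} (ok : A → Bool) where

  everyLetter : Automaton A
  everyLetter = record { State = Bool ; start = true ; next = λ b a → b ∧ ok a ; accepting = id }

  private
    run-everyLetter : ∀ b w → foldl (Automaton.next everyLetter) b w ≡ b ∧ all ok w
    run-everyLetter b []      = sym (∧-identityʳ b)
    run-everyLetter b (a ∷ w) = trans (run-everyLetter (b ∧ ok a) w) (∧-assoc b (ok a) (all ok w))

  Accepts-everyLetter : ∀ w → Automaton.Accepts everyLetter w ⇔ All (T ∘ ok) w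
  Accepts-everyLetter w rewrite run-everyLetter true w = mk⇔ (all⁺ ok w) (all⁻ ok)

expect : {A S : Set} → DecidableEquality A → A → A → S → Maybe S
expect _≟ᴬ_ a e s with a ≟ᴬ e
... | yes _ = just s
... | no  _ = nothing

module WithSink {A S : Set} (next : S → A → Maybe S) (accepting : S → Bool) where

  next? : Maybe S → A → Maybe S
  next? nothing  _ = nothing
  next? (just s) a = next s a

  accepting? : Maybe S → Bool
  accepting? nothing  = false
  accepting? (just s) = accepting s

  withSink : S → Automaton A
  withSink s₀ = record { State = Maybe S ; start = just s₀ ; next = next? ; accepting = accepting? }

  AcceptedFrom : Maybe S → List A → Set
  AcceptedFrom s w = T (accepting? (foldl next? s w))

  sink-rejects : ∀ w → ¬ AcceptedFrom nothing w
  sink-rejects []      ()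
  sink-rejects (_ ∷ w) = sink-rejects w

  module _ (_≟ᴬ_ : DecidableEquality A) where

    expect-sound : ∀ a e s w → AcceptedFrom (expect _≟ᴬ_ a e s) w → a ≡ e × AcceptedFrom (just s) w
    expect-sound a e s w acc with a ≟ᴬ e
    ... | yes a≡e = a≡e , acc
    ... | no  _   = ⊥-elim (sink-rejects w acc)

    expect-complete : ∀ e s w → AcceptedFrom (just s) w → AcceptedFrom (expect _≟ᴬ_ e e s) w
    expect-complete e s w acc with e ≟ᴬ e
    ... | yes _   = acc
    ... | no  e≢e = ⊥-elim (e≢e refl)

-- Languages of bounded length are regular

module _ {k : ℕ} where

  wordCodes : ℕ → ℕ
  wordCodes zero    = 1
  wordCodes (suc n) = suc (k * wordCodes n)

  codeWord : ∀ n → Word k → Fin (wordCodes n)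
  codeWord zero    _       = zero
  codeWord (suc n) []      = zero
  codeWord (suc n) (c ∷ w) = suc (combine c (codeWord n w))

  decodeWord : ∀ n → Fin (wordCodes n) → Word k
  decodeCons : ∀ n → Fin k × Fin (wordCodes n) → Word k
  decodeWord zero    _       = []
  decodeWord (suc n) zero    = []
  decodeWord (suc n) (suc i) = decodeCons n (remQuot (wordCodes n) i)
  decodeCons n (c , j) = c ∷ decodeWord n j

  decode-codeWord : ∀ n w → length w ≤ n → decodeWord n (codeWord n w) ≡ w
  decode-codeWord zero    []      _           = refl
  decode-codeWord (suc n) []      _           = refl
  decode-codeWord (suc n) (c ∷ w) (s≤s |w|≤n) =
    trans (cong (decodeCons n) (remQuot-combine c (codeWord n w))) (cong (c ∷_) (decode-codeWord n w |w|≤n))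

module BoundedLanguage {k : ℕ} (bound : ℕ) {P : Word k → Set} (P? : Decidable P)
                       (short : ∀ w → P w → length w ≤ bound) where

  private
    extend : Word k → Fin k → Word k
    extend w c = if length w ≤ᵇ bound then w ∷ʳ c else w

    recorder : Automaton (Fin k)
    recorder = record
      { State = Word k ; start = [] ; next = extend
      ; accepting = λ w → (length w ≤ᵇ bound) ∧ ⌊ P? w ⌋ }

    length-extend : ∀ w c → length w ≤ suc bound → length (extend w c) ≤ suc bound
    length-extend w c |w|≤ with length w ≤ᵇ bound in eq
    ... | true  rewrite length-++ w {c ∷ []} | +-comm (length w) 1 = s≤s (≤ᵇ⇒≤ _ _ (subst T (sym eq) tt))
    ... | false = |w|≤

    coding : FiniteCoding recorder
    coding = record
      { size = wordCodes {k} (suc bound) ; code = codeWord (suc bound) ; decode = decodeWord (suc bound)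
      ; Invariant = λ w → length w ≤ suc bound ; invariant-start = z≤n
      ; invariant-next = length-extend ; decode-code = decode-codeWord (suc bound) }

    length-≤-++ : ∀ (w : Word k) c u → length w ≤ length (w ++ c ∷ u)
    length-≤-++ w c u rewrite length-++ w {c ∷ u} = m≤m+n _ _

    record-short : ∀ w u → length (w ++ u) ≤ bound → foldl extend w u ≡ w ++ u
    record-short w []      _ = sym (++-identityʳ w)
    record-short w (c ∷ u) |wcu|≤ with length w ≤ᵇ bound in eq
    ... | true  = trans (record-short (w ∷ʳ c) u (subst (λ v → length v ≤ bound) (sym (∷ʳ-++ w c u)) |wcu|≤))
                        (∷ʳ-++ w c u)
    ... | false = ⊥-elim (subst T eq (≤⇒≤ᵇ (≤-trans (length-≤-++ w c u) |wcu|≤)))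

    record-stuck : ∀ w u → (length w ≤ᵇ bound) ≡ false → foldl extend w u ≡ w
    record-stuck w []      _  = refl
    record-stuck w (c ∷ u) eq rewrite eq = record-stuck w u eq

    recorded-short : ∀ w u → length (foldl extend w u) ≤ bound → foldl extend w u ≡ w ++ u
    recorded-short w []      _ = sym (++-identityʳ w)
    recorded-short w (c ∷ u) short-run with length w ≤ᵇ bound in eq
    ... | true  = trans (recorded-short (w ∷ʳ c) u short-run) (∷ʳ-++ w c u)
    ... | false = ⊥-elim (subst T eq (≤⇒≤ᵇ (subst (λ v → length v ≤ bound) (record-stuck w u eq) short-run)))

  opaque
    boundedDFA : DFA (Fin k)
    boundedDFA = toDFA recorder coding

    accepts-boundedDFA : ∀ w → accepts boundedDFA w ⇔ P w
    accepts-boundedDFA w = ⇔-trans (accepts-toDFA recorder coding w) (mk⇔ sound complete)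
      where
        sound : Automaton.Accepts recorder w → P w
        sound acc with Equivalence.to T-∧ acc
        ... | short-run , p-run rewrite recorded-short [] w (≤ᵇ⇒≤ _ _ short-run) = toWitness p-run

        complete : P w → Automaton.Accepts recorder w
        complete p rewrite record-short [] w (short w p) =
          Equivalence.from T-∧ (≤⇒≤ᵇ (short w p) , fromWitness p)

-- Pumping and components

module _ {A : Set} (D : DFA A) (a : A) where
  open DFA D

  private
    repeat : Fin (suc n) → ℕ → Fin (suc n)
    repeat s j = run s (replicate j a)

    repeat-+ : ∀ s i j → repeat s (i + j) ≡ repeat (repeat s i) j
    repeat-+ s zero    j = refl
    repeat-+ s (suc i) j = repeat-+ (δ s a) i j

  -- By pigeonhole, two of the words Y a^0, …, Y a^(suc n) lead to the same one of the suc n states.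
  pumping : ∀ Y → ∃[ d ] (run zero (Y ++ replicate (suc n) a) ≡ run zero (Y ++ replicate (suc n + suc d) a))
  pumping Y with pigeonhole ≤-refl (λ j → repeat (run zero Y) (toℕ j))
  ... | i , j , i<j , same-state with m≤n⇒∃[o]m+o≡n i<j | m≤n⇒∃[o]m+o≡n (≤-pred (toℕ<n i))
  ...   | d , i+1+d≡j | r , i+r≡N = d , (begin
    run zero (Y ++ replicate (suc n) a)          ≡⟨ foldl-++ δ zero Y _ ⟩
    repeat s (suc n)                             ≡⟨ cong (repeat s) (sym i+r≡N) ⟩
    repeat s (toℕ i + r)                         ≡⟨ repeat-+ s (toℕ i) r ⟩
    repeat (repeat s (toℕ i)) r                  ≡⟨ cong (λ t → repeat t r) same-state ⟩
    repeat (repeat s (toℕ j)) r                  ≡⟨ repeat-+ s (toℕ j) r ⟨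
    repeat s (toℕ j + r)                         ≡⟨ cong (repeat s) j+r≡N+1+d ⟩
    repeat s (suc n + suc d)                     ≡⟨ foldl-++ δ zero Y _ ⟨
    run zero (Y ++ replicate (suc n + suc d) a)  ∎)
    where
      open ≡-Reasoning
      s = run zero Y
      j+r≡N+1+d : toℕ j + r ≡ suc n + suc d
      j+r≡N+1+d = begin
        toℕ j + r              ≡⟨ cong (_+ r) i+1+d≡j ⟨
        suc (toℕ i + d) + r    ≡⟨ cong suc (trans (+-assoc (toℕ i) d r) (cong (toℕ i +_) (+-comm d r))) ⟩
        suc (toℕ i + (r + d))  ≡⟨ cong suc (+-assoc (toℕ i) r d) ⟨
        suc (toℕ i + r + d)    ≡⟨ cong (λ m → suc (m + d)) i+r≡N ⟩
        suc (suc n + d)        ≡⟨ +-suc (suc n) d ⟨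
        suc n + suc d          ∎

module _ {k : ℕ} (G : AutoPres k) (D : DFA (Fin k)) where

  accepts-componentwise : UnionOfComponents G D →
                          ∀ {u v} → EqClosure (AutoPres.Edge G) u v → accepts D u ⇔ accepts D v
  accepts-componentwise (_ , closed) = gfold ⇔-isEquivalence (accepts D) (λ {u} {v} → closed u v)

-- Cellular automata and the automaticity of their step

Rule : Set → Set
Rule Γ = Γ → Γ → Γ → Γ

module _ {Γ : Set} where

  firstOr : List Γ → Γ → Γ
  firstOr []      r = r
  firstOr (c ∷ _) r = c

  lastOr : Γ → List Γ → Γ
  lastOr l []       = l
  lastOr l (c ∷ cs) = lastOr c cs

  firstOr-++ : ∀ cs ds r → firstOr (cs ++ ds) r ≡ firstOr cs (firstOr ds r)
  firstOr-++ []      ds r = refl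
  firstOr-++ (c ∷ _) ds r = refl

module _ {Γ : Set} (ρ : Rule Γ) where

  sweep : Γ → List Γ → Γ → List Γ
  sweep l []       r = []
  sweep l (c ∷ cs) r = ρ l c (firstOr cs r) ∷ sweep c cs r

  sweep-++ : ∀ l cs ds r → sweep l (cs ++ ds) r ≡ sweep l cs (firstOr ds r) ++ sweep (lastOr l cs) ds r
  sweep-++ l []       ds r = refl
  sweep-++ l (c ∷ cs) ds r rewrite firstOr-++ cs ds r =
    cong (ρ l c (firstOr cs (firstOr ds r)) ∷_) (sweep-++ c cs ds r)

  length-sweep : ∀ l cs r → length (sweep l cs r) ≡ length cs
  length-sweep l []       r = refl
  length-sweep l (c ∷ cs) r = cong suc (length-sweep c cs r)

  grow : Γ → Γ → List Γ → List Γ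
  grow b p u = sweep b (b ∷ u ++ p ∷ p ∷ []) p

module _ {Γ Δ : Set} (ρ : Rule Γ) (e : Γ → Δ) (d : Δ → Γ) where

  sweep-conjugate : ∀ l cs r →
    sweep (λ x y z → e (ρ (d x) (d y) (d z))) l cs r ≡ map e (sweep ρ (d l) (map d cs) (d r))
  sweep-conjugate l []           r = refl
  sweep-conjugate l (c ∷ [])     r = refl
  sweep-conjugate l (c ∷ c′ ∷ cs) r = cong (e (ρ (d l) (d c) (d c′)) ∷_) (sweep-conjugate c (c′ ∷ cs) r)

Pair : ℕ → Set
Pair k = Maybe (Fin k) × Maybe (Fin k)

_≟ᴾ_ : ∀ {k} → DecidableEquality (Pair k)
_≟ᴾ_ = ≡-dec× (≡-decᴹ _≟_) (≡-decᴹ _≟_)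

-- Output letter i of grow ρ b p u is ρ applied to input letters i - 2, i - 1 and i (with b b in front
-- and p p p behind), so the checker remembers the last two input letters and, once u is exhausted,
-- how many output letters are still due.
module GrowthChecker {k : ℕ} (ρ : Rule (Fin k)) (b p : Fin k) where

  data Stage : Set where
    reading flushing₂ flushing₁ finished : Stage

  Window : Set
  Window = Fin k × Fin k × Stage

  private
    check : Window → Pair k → Maybe Window
    complete : Window → Bool
    expect′ : Pair k → Pair k → Window → Maybe Window
    expect′ = expect _≟ᴾ_

    check (x , y , reading)   a@(just c  , _) = expect′ a (just c , just (ρ x y c)) (y , c , reading)
    check (x , y , reading)   a@(nothing , _) = expect′ a (nothing , just (ρ x y p)) (y , p , flushing₂)
    check (x , y , flushing₂) a               = expect′ a (nothing , just (ρ x y p)) (y , p , flushing₁)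
    check (x , y , flushing₁) a               = expect′ a (nothing , just (ρ x y p)) (y , p , finished)
    check (x , y , finished)  _               = nothing

    complete (_ , _ , finished) = true
    complete _                  = false

  checker : Automaton (Pair k)
  checker = WithSink.withSink check complete (b , b , reading)

  checker-finite : Maybe Window ↪ Fin (suc (k * (k * 4)))
  checker-finite = maybe-↪Fin (↪-id _ ×-↪Fin (↪-id _ ×-↪Fin stage-↪))
    where
      stage-↪ : Stage ↪ Fin 4
      stage-↪ = mk↪ₛ to from (λ { reading → refl ; flushing₂ → refl ; flushing₁ → refl ; finished → refl })
        where
          to : Stage → Fin 4
          to reading   = 0F
          to flushing₂ = 1F
          to flushing₁ = 2F
          to finished  = 3F
          from : Fin 4 → Stage
          from 0F = reading
          from 1F = flushing₂
          from 2F = flushing₁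
          from 3F = finished

  private
    open WithSink check complete

    owed : Stage → ℕ
    owed reading   = 3
    owed flushing₂ = 2
    owed flushing₁ = 1
    owed finished  = 0

    flush : ℕ → Fin k → Fin k → Word k
    flush zero    x y = []
    flush (suc n) x y = ρ x y p ∷ flush n y p

    flush-step : ∀ x y {c} s w → c ≡ ρ x y p → AcceptedFrom (just (y , p , s)) w →
                 AcceptedFrom (expect′ (nothing , just c) (nothing , just (ρ x y p)) (y , p , s)) w
    flush-step x y s w refl = expect-complete _≟ᴾ_ _ (y , p , s) w

    flush-sound : ∀ s x y v → AcceptedFrom (just (x , y , s)) (conv [] v) → v ≡ flush (owed s) x y
    flush-sound finished  x y []      _   = refl
    flush-sound finished  x y (_ ∷ v) acc = ⊥-elim (sink-rejects (conv [] v) acc)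
    flush-sound reading   x y (c ∷ v) acc with expect-sound _≟ᴾ_ _ _ _ (conv [] v) acc
    ... | refl , acc′ = cong (_ ∷_) (flush-sound flushing₂ y p v acc′)
    flush-sound flushing₂ x y (c ∷ v) acc with expect-sound _≟ᴾ_ _ _ _ (conv [] v) acc
    ... | refl , acc′ = cong (_ ∷_) (flush-sound flushing₁ y p v acc′)
    flush-sound flushing₁ x y (c ∷ v) acc with expect-sound _≟ᴾ_ _ _ _ (conv [] v) acc
    ... | refl , acc′ = cong (_ ∷_) (flush-sound finished y p v acc′)

    flush-complete : ∀ s x y v → v ≡ flush (owed s) x y → AcceptedFrom (just (x , y , s)) (conv [] v)
    flush-complete finished  x y []      _    = tt
    flush-complete finished  x y (_ ∷ _) ()
    flush-complete flushing₁ x y []      ()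
    flush-complete flushing₂ x y []      ()
    flush-complete reading   x y []      ()
    flush-complete flushing₁ x y (c ∷ v) eq =
      flush-step x y finished (conv [] v) (∷-injectiveˡ eq) (flush-complete finished  y p v (∷-injectiveʳ eq))
    flush-complete flushing₂ x y (c ∷ v) eq =
      flush-step x y flushing₁ (conv [] v) (∷-injectiveˡ eq) (flush-complete flushing₁ y p v (∷-injectiveʳ eq))
    flush-complete reading   x y (c ∷ v) eq =
      flush-step x y flushing₂ (conv [] v) (∷-injectiveˡ eq) (flush-complete flushing₂ y p v (∷-injectiveʳ eq))

    read-sound : ∀ x y u v → AcceptedFrom (just (x , y , reading)) (conv u v) → v ≡ sweep ρ x (y ∷ u ++ p ∷ p ∷ []) p
    read-sound x y []      v       acc = flush-sound reading x y v acc
    read-sound x y (c ∷ u) []      acc with expect-sound _≟ᴾ_ _ _ _ (conv u []) acc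
    ... | () , _
    read-sound x y (c ∷ u) (w ∷ v) acc with expect-sound _≟ᴾ_ _ _ _ (conv u v) acc
    ... | refl , acc′ = cong (_ ∷_) (read-sound y c u v acc′)

    read-complete : ∀ x y u → AcceptedFrom (just (x , y , reading)) (conv u (sweep ρ x (y ∷ u ++ p ∷ p ∷ []) p))
    read-complete x y []      = flush-complete reading x y _ refl
    read-complete x y (c ∷ u) =
      expect-complete _≟ᴾ_ (just c , just (ρ x y c)) (y , c , reading) (conv u (sweep ρ y (c ∷ u ++ p ∷ p ∷ []) p))
        (read-complete y c u)

  accepts-checker : ∀ u v → Automaton.Accepts checker (conv u v) ⇔ v ≡ grow ρ b p u
  accepts-checker u v = mk⇔ (read-sound b b u v) (λ { refl → read-complete b b u })

Ladder : ∀ {k} → Fin k → Fin k → Word k → Word k → Set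
Ladder h a u v = ∃[ d ] (u ≡ h ∷ replicate (suc d) a × v ≡ h ∷ replicate (suc (suc d)) a)

module LadderChecker {k : ℕ} (h a : Fin k) where

  data Rung : Set where
    atHead afterHead climbing closed : Rung

  private
    climb : Rung → Pair k → Maybe Rung
    climb atHead    l = expect _≟ᴾ_ l (just h  , just h) afterHead
    climb afterHead l = expect _≟ᴾ_ l (just a  , just a) climbing
    climb climbing  l@(just _ , _) = expect _≟ᴾ_ l (just a  , just a) climbing
    climb climbing  l@(nothing , _) = expect _≟ᴾ_ l (nothing , just a) closed
    climb closed    _ = nothing

    isClosed : Rung → Bool
    isClosed closed = true
    isClosed _      = false

    open WithSink climb isClosed

  checker : Automaton (Pair k)
  checker = withSink atHead

  checker-finite : Maybe Rung ↪ Fin 5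
  checker-finite = maybe-↪Fin (mk↪ₛ to from (λ { atHead → refl ; afterHead → refl ; climbing → refl ; closed → refl }))
    where
      to : Rung → Fin 4
      to atHead    = 0F
      to afterHead = 1F
      to climbing  = 2F
      to closed    = 3F
      from : Fin 4 → Rung
      from 0F = atHead
      from 1F = afterHead
      from 2F = climbing
      from 3F = closed

  private
    climbing-sound : ∀ u v → AcceptedFrom (just climbing) (conv u v) →
                     ∃[ d ] (u ≡ replicate d a × v ≡ replicate (suc d) a)
    climbing-sound []      []      ()
    climbing-sound []      (c ∷ v) acc with expect-sound _≟ᴾ_ _ _ _ (conv [] v) acc
    climbing-sound []      (c ∷ []) acc | refl , _ = 0 , refl , refl
    climbing-sound []      (c ∷ c′ ∷ v) acc | refl , acc′ = ⊥-elim (sink-rejects (conv [] v) acc′)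
    climbing-sound (c ∷ u) []      acc with expect-sound _≟ᴾ_ _ _ _ (conv u []) acc
    ... | () , _
    climbing-sound (c ∷ u) (c′ ∷ v) acc with expect-sound _≟ᴾ_ _ _ _ (conv u v) acc
    ... | refl , acc′ with climbing-sound u v acc′
    ...   | d , refl , refl = suc d , refl , refl

    climbing-complete : ∀ d → AcceptedFrom (just climbing) (conv (replicate d a) (replicate (suc d) a))
    climbing-complete zero    = expect-complete _≟ᴾ_ (nothing , just a) closed [] tt
    climbing-complete (suc d) =
      expect-complete _≟ᴾ_ (just a , just a) climbing (conv (replicate d a) (replicate (suc d) a)) (climbing-complete d)

    admits-only : ∀ {r s} e e′ → isClosed r ≡ false → (∀ l → climb r l ≡ expect _≟ᴾ_ l (just e , just e′) s) →
                  ∀ u v → AcceptedFrom (just r) (conv u v) →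
                  ∃[ u′ ] ∃[ v′ ] (u ≡ e ∷ u′ × v ≡ e′ ∷ v′ × AcceptedFrom (just s) (conv u′ v′))
    admits-only {r} {s} e e′ open′ step = go
      where
        first : ∀ l w → AcceptedFrom (climb r l) w → l ≡ (just e , just e′) × AcceptedFrom (just s) w
        first l w acc = expect-sound _≟ᴾ_ l (just e , just e′) s w (subst (λ t → AcceptedFrom t w) (step l) acc)

        go : ∀ u v → AcceptedFrom (just r) (conv u v) →
             ∃[ u′ ] ∃[ v′ ] (u ≡ e ∷ u′ × v ≡ e′ ∷ v′ × AcceptedFrom (just s) (conv u′ v′))
        go []      []       acc = ⊥-elim (subst T open′ acc)
        go []      (c′ ∷ v) acc with first (nothing , just c′) (conv [] v) acc
        ... | () , _
        go (c ∷ u) []       acc with first (just c , nothing) (conv u []) acc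
        ... | () , _
        go (c ∷ u) (c′ ∷ v) acc with first (just c , just c′) (conv u v) acc
        ... | refl , acc′ = u , v , refl , refl , acc′

  accepts-checker : ∀ u v → Automaton.Accepts checker (conv u v) ⇔ Ladder h a u v
  accepts-checker u v = mk⇔ (sound u v) complete
    where
      sound : ∀ u v → AcceptedFrom (just atHead) (conv u v) → Ladder h a u v
      sound u v acc with admits-only h h refl (λ _ → refl) u v acc
      ... | u′ , v′ , refl , refl , acc′ with admits-only a a refl (λ _ → refl) u′ v′ acc′
      ...   | u″ , v″ , refl , refl , acc″ with climbing-sound u″ v″ acc″
      ...     | d , refl , refl = d , refl , refl

      complete : Ladder h a u v → AcceptedFrom (just atHead) (conv u v)
      complete (d , refl , refl) =
        expect-complete _≟ᴾ_ (just h , just h) afterHead (conv (replicate (suc d) a) (replicate (suc (suc d)) a))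
          (expect-complete _≟ᴾ_ (just a , just a) climbing (conv (replicate d a) (replicate (suc d) a)) (climbing-complete d))

-- The reduction

module Reduction (M : TM) where

  Sym : Set
  Sym = Fin (suc (TM.g M))

  St : Set
  St = Fin (suc (TM.q M))

  blank : Sym
  blank = zero

  δM : St → Sym → Maybe (St × Sym × Move)
  δM = TM.δ M

  -- Clock letters accumulate right of the tape, one per simulated step.
  data Letter : Set where
    clock pad border halted : Letter
    cell : Sym → Letter
    head : St → Sym → Letter

  K : ℕ
  K = 4 + (suc (TM.g M) + suc (TM.q M) * suc (TM.g M))

  letter-↪ : Letter ↪ Fin K
  letter-↪ = (↪-id _ ⊎-↪Fin (↪-id _ ⊎-↪Fin (↪-id _ ×-↪Fin ↪-id _))) ↪-∘ mk↪ₛ to from from-to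
    where
      to : Letter → Fin 4 ⊎ (Sym ⊎ St × Sym)
      to clock      = inj₁ 0F
      to pad        = inj₁ 1F
      to border     = inj₁ 2F
      to halted     = inj₁ 3F
      to (cell s)   = inj₂ (inj₁ s)
      to (head q s) = inj₂ (inj₂ (q , s))
      from : Fin 4 ⊎ (Sym ⊎ St × Sym) → Letter
      from (inj₁ 0F)             = clock
      from (inj₁ 1F)             = pad
      from (inj₁ 2F)             = border
      from (inj₁ 3F)             = halted
      from (inj₂ (inj₁ s))       = cell s
      from (inj₂ (inj₂ (q , s))) = head q s
      from-to : ∀ c → from (to c) ≡ c
      from-to clock      = refl
      from-to pad        = refl
      from-to border     = refl
      from-to halted     = refl
      from-to (cell s)   = refl
      from-to (head q s) = refl

  opaque
    encode : Letter → Fin K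
    encode = RightInverse.to letter-↪

    decode : Fin K → Letter
    decode = RightInverse.from letter-↪

    decode-encode : ∀ c → decode (encode c) ≡ c
    decode-encode = RightInverse.strictlyInverseʳ letter-↪

  W : Set
  W = Word K

  rightward leftward : Maybe (St × Sym × Move) → Maybe St
  rightward (just (q , _ , R)) = just q
  rightward _                  = nothing
  leftward (just (q , _ , L)) = just q
  leftward _                  = nothing

  fromLeft fromRight : Letter → Maybe St
  fromLeft (head q s) = rightward (δM q s)
  fromLeft _          = nothing
  fromRight (head q s) = leftward (δM q s)
  fromRight _          = nothing

  enter : Maybe St → Sym → Letter
  enter (just q) s = head q s
  enter nothing  s = cell s

  written : Maybe (St × Sym × Move) → Letter
  written nothing            = halted
  written (just (_ , b , _)) = cell b

  isClockLike : Letter → Bool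
  isClockLike clock = true
  isClockLike pad   = true
  isClockLike _     = false

  beyondTape : Letter → Letter
  beyondTape l = if isClockLike l then clock else enter (fromLeft l) blank

  rule : Rule Letter
  rule l border     r = enter (fromRight r) blank
  rule l pad        r = beyondTape l
  rule l clock      r = beyondTape l
  rule l (cell s)   r = enter (fromLeft l <∣> fromRight r) s
  rule l (head q s) r = written (δM q s)
  rule l halted     r = halted

  codeRule : Rule (Fin K)
  codeRule x y z = encode (rule (decode x) (decode y) (decode z))

  evolve : W → W
  evolve = grow codeRule (encode border) (encode pad)

  evolve-decode : ∀ u → evolve u ≡ map encode (grow rule border pad (map decode u))
  evolve-decode u = begin
    evolve u
      ≡⟨ sweep-conjugate rule encode decode b′ (b′ ∷ u ++ p′ ∷ p′ ∷ []) p′ ⟩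
    map encode (sweep rule (decode b′) (decode b′ ∷ map decode (u ++ p′ ∷ p′ ∷ [])) (decode p′))
      ≡⟨ cong (λ v → map encode (sweep rule (decode b′) (decode b′ ∷ v) (decode p′))) (map-++ decode u _) ⟩
    map encode (sweep rule (decode b′) (decode b′ ∷ map decode u ++ decode p′ ∷ decode p′ ∷ []) (decode p′))
      ≡⟨ cong₂ (λ b p → map encode (grow rule b p (map decode u))) (decode-encode border) (decode-encode pad) ⟩
    map encode (grow rule border pad (map decode u)) ∎
    where
      open ≡-Reasoning
      b′ = encode border
      p′ = encode pad

  isHalted : Letter → Bool
  isHalted halted = true
  isHalted _      = false

  running : Fin K → Bool
  running c = not (isHalted (decode c))


  start₀ clock₀ : Fin K
  start₀ = encode (head zero blank)
  clock₀ = encode clock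

  module Growth = GrowthChecker codeRule (encode border) (encode pad)
  module Climb = LadderChecker start₀ clock₀

  opaque
    domainDFA : DFA (Fin K)
    domainDFA = toDFA (everyLetter running) (finiteCoding (↔⇒↪ (↔-sym 2↔Bool)))

    edgeDFA : DFA (Pair K)
    edgeDFA = toDFA (Growth.checker ∪ᴬ Climb.checker) (finiteCoding (Growth.checker-finite ×-↪Fin Climb.checker-finite))

    accepts-domain : ∀ u → accepts domainDFA u ⇔ All (T ∘ running) u
    accepts-domain u = ⇔-trans (accepts-toDFA (everyLetter running) _ u) (Accepts-everyLetter running u)

    accepts-edge : ∀ u v → accepts edgeDFA (conv u v) ⇔ (v ≡ evolve u ⊎ Ladder start₀ clock₀ u v)
    accepts-edge u v =
      ⇔-trans (accepts-toDFA (Growth.checker ∪ᴬ Climb.checker) _ (conv u v))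
        (⇔-trans (Accepts-∪ Growth.checker Climb.checker (conv u v))
          (Growth.accepts-checker u v ⊎-⇔ Climb.accepts-checker u v))

  graph : AutoPres K
  graph = record { domA = domainDFA ; edgeA = edgeDFA }

  Dom : W → Set
  Dom = AutoPres.Dom graph

  Edge : W → W → Set
  Edge = AutoPres.Edge graph

  edge-evolve : ∀ u v → Dom u → Dom v → v ≡ evolve u → Edge u v
  edge-evolve u v du dv v≡ = du , dv , Equivalence.from (accepts-edge u v) (inj₁ v≡)

  edge-ladder : ∀ u v → Dom u → Dom v → Ladder start₀ clock₀ u v → Edge u v
  edge-ladder u v du dv ladder = du , dv , Equivalence.from (accepts-edge u v) (inj₂ ladder)

  nearest : List Sym → Sym
  nearest []      = blank
  nearest (x ∷ _) = x

  farther : List Sym → List Sym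
  farther []       = []
  farther (_ ∷ xs) = xs

  -- A configuration together with the number of cells shown on each side of the head.
  record Frame : Set where
    constructor frame
    field
      cfg    : Config M
      widthL : ℕ
      widthR : ℕ

  advance : Frame → Maybe Frame
  advance (frame (config q l s r) wl wr) with δM q s
  ... | nothing           = nothing
  ... | just (q′ , b , R) = just (frame (config q′ (b ∷ l) (nearest r) (farther r)) (2 + wl) wr)
  ... | just (q′ , b , L) = just (frame (config q′ (farther l) (nearest l) (b ∷ r)) wl (2 + wr))

  step-advance : ∀ f → step M (Frame.cfg f) ≡ mapᴹ Frame.cfg (advance f)
  step-advance (frame (config q l s r) wl wr) with δM q s
  ... | nothing = refl
  ... | just (q′ , b , R) with r
  ...   | []    = refl
  ...   | _ ∷ _ = refl
  step-advance (frame (config q l s r) wl wr) | just (q′ , b , L) with l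
  ...   | []    = refl
  ...   | _ ∷ _ = refl

  advanceⁿ : ℕ → Frame → Maybe Frame
  advanceⁿ zero    f = just f
  advanceⁿ (suc n) f = advance f >>= advanceⁿ n

  iterate-advanceⁿ : ∀ n f → iterate M n (Frame.cfg f) ≡ mapᴹ Frame.cfg (advanceⁿ n f)
  iterate-advanceⁿ zero    f = refl
  iterate-advanceⁿ (suc n) f rewrite step-advance f with advance f
  ... | nothing = refl
  ... | just f′ = iterate-advanceⁿ n f′

  Fits : Frame → Set
  Fits (frame (config _ l _ r) wl wr) = length l ≤ wl × length r ≤ wr

  private
    length-farther : ∀ xs n → length xs ≤ suc n → length (farther xs) ≤ n
    length-farther []       n _         = z≤n
    length-farther (_ ∷ xs) n (s≤s |xs|≤n) = |xs|≤n

    length-farther′ : ∀ xs n → length xs ≤ n → length (farther xs) ≤ n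
    length-farther′ []       n       _           = z≤n
    length-farther′ (_ ∷ xs) (suc n) (s≤s |xs|≤n) = m≤n⇒m≤1+n |xs|≤n

  advance-fits : ∀ f f′ → Fits f → advance f ≡ just f′ → Fits f′
  advance-fits (frame (config q l s r) wl wr) f′ (l≤ , r≤) eq with δM q s
  advance-fits _ _ (l≤ , r≤) () | nothing
  advance-fits (frame (config q l s r) wl wr) _ (l≤ , r≤) refl | just (q′ , b , R) =
    s≤s (m≤n⇒m≤1+n l≤) , length-farther′ r wr r≤
  advance-fits (frame (config q l s r) wl wr) _ (l≤ , r≤) refl | just (q′ , b , L) =
    length-farther′ l wl l≤ , s≤s (m≤n⇒m≤1+n r≤)

  leftCells : ℕ → List Sym → List Sym
  leftCells zero    _ = []
  leftCells (suc n) l = leftCells n (farther l) ∷ʳ nearest l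

  rightCells : ℕ → List Sym → List Sym
  rightCells zero    _ = []
  rightCells (suc n) r = nearest r ∷ rightCells n (farther r)

  leftCells-pad : ∀ n l → length l ≤ n → leftCells (suc n) l ≡ blank ∷ leftCells n l
  leftCells-pad zero    []  _ = refl
  leftCells-pad (suc n) l l≤ rewrite leftCells-pad n (farther l) (length-farther l n l≤) = refl

  rightCells-pad : ∀ n r → length r ≤ n → rightCells (suc n) r ≡ rightCells n r ∷ʳ blank
  rightCells-pad zero    []  _ = refl
  rightCells-pad (suc n) r r≤ rewrite rightCells-pad n (farther r) (length-farther r n r≤) = refl

  cells : List Sym → List Letter
  cells = map cell

  clocks : ℕ → List Letter
  clocks m = replicate m clock

  display : Frame → List Letter
  display (frame (config q l s r) wl wr) = cells (leftCells wl l) ++ head q s ∷ cells (rightCells wr r)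

  word : Frame → ℕ → W
  word f m = map encode (display f ++ clocks m)

  AllClockLike : List Letter → Set
  AllClockLike = All (λ c → isClockLike c ≡ true)

  tape-end : List Letter
  tape-end = pad ∷ pad ∷ []

  private
    cells-snoc : ∀ xs x ys → cells (xs ∷ʳ x) ++ ys ≡ cells xs ++ cell x ∷ ys
    cells-snoc xs x ys = trans (cong (_++ ys) (map-++ cell xs (x ∷ []))) (++-assoc (cells xs) (cell x ∷ []) ys)

    fromRight-firstOr-cells : ∀ cs r → fromRight r ≡ nothing → fromRight (firstOr (cells cs) r) ≡ nothing
    fromRight-firstOr-cells []      r eq = eq
    fromRight-firstOr-cells (_ ∷ _) r eq = refl

    lastOr-cells : ∀ l cs → fromLeft l ≡ nothing → isClockLike l ≡ false →
                   fromLeft (lastOr l (cells cs)) ≡ nothing × isClockLike (lastOr l (cells cs)) ≡ false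
    lastOr-cells l []       l-fixed l-tape = l-fixed , l-tape
    lastOr-cells l (c ∷ cs) _       _      = lastOr-cells (cell c) cs refl refl

    enter-nothing : ∀ {m} s → m ≡ nothing → enter m s ≡ cell s
    enter-nothing s refl = refl

    enter-just : ∀ {m q} s → m ≡ just q → enter m s ≡ head q s
    enter-just s refl = refl

  sweep-cells : ∀ l cs r → fromLeft l ≡ nothing → fromRight r ≡ nothing → sweep rule l (cells cs) r ≡ cells cs
  sweep-cells l []       r _ _ = refl
  sweep-cells l (s ∷ cs) r l-fixed r-fixed rewrite l-fixed =
    cong₂ _∷_ (enter-nothing s (fromRight-firstOr-cells cs r r-fixed)) (sweep-cells (cell s) cs r refl r-fixed)

  sweep-clocks : ∀ l as r → isClockLike l ≡ true → AllClockLike as → sweep rule l as r ≡ clocks (length as)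
  sweep-clocks l []       r _ []                    = refl
  sweep-clocks l (clock ∷ as) r l-clock (_ ∷ as-clock) rewrite l-clock = cong (clock ∷_) (sweep-clocks clock as r refl as-clock)
  sweep-clocks l (pad ∷ as)   r l-clock (_ ∷ as-clock) rewrite l-clock = cong (clock ∷_) (sweep-clocks pad as r refl as-clock)

  private
    rule-clockLike : ∀ l c r → isClockLike c ≡ true → rule l c r ≡ beyondTape l
    rule-clockLike l clock r _ = refl
    rule-clockLike l pad   r _ = refl

    sweep-from-tape : ∀ l c cs r → isClockLike l ≡ false → isClockLike c ≡ true → AllClockLike cs →
                      sweep rule l (c ∷ cs) r ≡ enter (fromLeft l) blank ∷ clocks (length cs)
    sweep-from-tape l c cs r l-tape c-clock cs-clock rewrite rule-clockLike l c (firstOr cs r) c-clock | l-tape =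
      cong (_ ∷_) (sweep-clocks c cs r c-clock cs-clock)

  sweep-tape-end : ∀ l as → isClockLike l ≡ false → AllClockLike as →
                   sweep rule l (as ++ tape-end) pad ≡ enter (fromLeft l) blank ∷ clocks (suc (length as))
  sweep-tape-end l []       l-tape []                  = sweep-from-tape l pad (pad ∷ []) pad l-tape refl (refl ∷ [])
  sweep-tape-end l (c ∷ as) l-tape (c-clock ∷ as-clock) =
    trans (sweep-from-tape l c (as ++ tape-end) pad l-tape c-clock (++⁺ as-clock (refl ∷ refl ∷ [])))
          (cong (λ n → _ ∷ clocks n) (trans (length-++ as) (+-comm (length as) 2)))

  private
    fromRight-firstOr-snoc : ∀ xs x r → fromRight (firstOr (cells (xs ∷ʳ x)) r) ≡ nothing
    fromRight-firstOr-snoc []      x r = refl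
    fromRight-firstOr-snoc (_ ∷ _) x r = refl

    fromRight-firstOr-end : ∀ m → fromRight (firstOr (clocks m ++ tape-end) pad) ≡ nothing
    fromRight-firstOr-end zero    = refl
    fromRight-firstOr-end (suc m) = refl

    reassoc : ∀ (Y : List Letter) h Z A B → ((Y ++ h ∷ Z) ++ A) ++ B ≡ Y ++ h ∷ (Z ++ A ++ B)
    reassoc Y h Z A B = trans (++-assoc (Y ++ h ∷ Z) A B) (++-assoc Y (h ∷ Z) (A ++ B))

  leftImage : List Sym → Letter → List Letter
  leftImage Lc H = enter (fromRight (firstOr (cells Lc) H)) blank ∷ sweep rule border (cells Lc) H

  rightImage : Letter → List Sym → ℕ → List Letter
  rightImage H Rc m = sweep rule H (cells Rc ++ clocks m ++ tape-end) pad

  grow-around-head : ∀ {t} Lc q s Rc m → δM q s ≡ t →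
    grow rule border pad ((cells Lc ++ head q s ∷ cells Rc) ++ clocks m)
      ≡ leftImage Lc (head q s) ++ written t ∷ rightImage (head q s) Rc m
  grow-around-head Lc q s Rc m refl
    rewrite reassoc (cells Lc) (head q s) (cells Rc) (clocks m) tape-end
          | firstOr-++ (cells Lc) (head q s ∷ cells Rc ++ clocks m ++ tape-end) pad
          | sweep-++ rule border (cells Lc) (head q s ∷ cells Rc ++ clocks m ++ tape-end) pad = refl

  left-stays : ∀ H Lc → fromRight H ≡ nothing → leftImage Lc H ≡ cells (blank ∷ Lc)
  left-stays H Lc H-stays =
    cong₂ _∷_ (enter-nothing blank (fromRight-firstOr-cells Lc H H-stays)) (sweep-cells border Lc H refl H-stays)

  left-moves : ∀ H q′ wl l → fromRight H ≡ just q′ → length l ≤ wl →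
    leftImage (leftCells wl l) H ≡ cells (leftCells wl (farther l)) ∷ʳ head q′ (nearest l)
  left-moves H q′ zero    []  H-left _  = cong (_∷ []) (enter-just blank H-left)
  left-moves H q′ (suc n) l H-left l≤ = begin
    leftImage (xs ∷ʳ x) H
      ≡⟨ cong₂ _∷_ (enter-nothing blank (fromRight-firstOr-snoc xs x H))
                   (trans (cong (λ cs → sweep rule border cs H) (map-++ cell xs (x ∷ [])))
                          (sweep-++ rule border (cells xs) (cell x ∷ []) H)) ⟩
    cell blank ∷ sweep rule border (cells xs) (cell x) ++ rule (lastOr border (cells xs)) (cell x) H ∷ []
      ≡⟨ cong₂ (λ ys y → cell blank ∷ ys ++ y ∷ []) (sweep-cells border xs (cell x) refl refl)
               (cong₂ (λ m₁ m₂ → enter (m₁ <∣> m₂) x) (proj₁ (lastOr-cells border xs refl refl)) H-left) ⟩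
    cells (blank ∷ xs) ∷ʳ head q′ x
      ≡⟨ cong (λ ys → cells ys ∷ʳ head q′ x) (leftCells-pad n (farther l) (length-farther l n l≤)) ⟨
    cells (leftCells (suc n) (farther l)) ∷ʳ head q′ x ∎
    where
      open ≡-Reasoning
      xs = leftCells n (farther l)
      x  = nearest l

  right-stays : ∀ H cs m → fromLeft H ≡ nothing → isClockLike H ≡ false →
    rightImage H cs m ≡ cells (cs ∷ʳ blank) ++ clocks (suc m)
  right-stays H cs m H-stays H-tape = begin
    sweep rule H (cells cs ++ clocks m ++ tape-end) pad
      ≡⟨ sweep-++ rule H (cells cs) (clocks m ++ tape-end) pad ⟩
    sweep rule H (cells cs) _ ++ sweep rule (lastOr H (cells cs)) (clocks m ++ tape-end) pad
      ≡⟨ cong₂ _++_ (sweep-cells H cs _ H-stays (fromRight-firstOr-end m))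
                    (sweep-tape-end _ (clocks m) (proj₂ last-fixed) (replicate⁺ m refl)) ⟩
    cells cs ++ enter (fromLeft (lastOr H (cells cs))) blank ∷ clocks (suc (length (clocks m)))
      ≡⟨ cong₂ (λ c n → cells cs ++ c ∷ clocks (suc n)) (enter-nothing blank (proj₁ last-fixed)) (length-replicate m) ⟩
    cells cs ++ cell blank ∷ clocks (suc m)
      ≡⟨ cells-snoc cs blank (clocks (suc m)) ⟨
    cells (cs ∷ʳ blank) ++ clocks (suc m) ∎
    where
      open ≡-Reasoning
      last-fixed = lastOr-cells H cs H-stays H-tape

  right-moves : ∀ H q′ wr r m → fromLeft H ≡ just q′ → isClockLike H ≡ false → length r ≤ wr →
    rightImage H (rightCells wr r) m ≡ head q′ (nearest r) ∷ cells (rightCells wr (farther r)) ++ clocks (suc m)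
  right-moves H q′ zero    []  m H-right H-tape _ =
    trans (sweep-tape-end H (clocks m) H-tape (replicate⁺ m refl))
          (cong₂ (λ c n → c ∷ clocks (suc n)) (enter-just blank H-right) (length-replicate m))
  right-moves H q′ (suc n) r m H-right H-tape r≤ =
    cong₂ _∷_ (cong (λ m₁ → enter (m₁ <∣> _) (nearest r)) H-right)
      (trans (right-stays (cell (nearest r)) (rightCells n (farther r)) m refl refl)
             (cong (λ cs → cells cs ++ clocks (suc m)) (sym (rightCells-pad n (farther r) (length-farther r n r≤)))))

  grow-moving-right : ∀ q l s r wl wr m {q′ b} → δM q s ≡ just (q′ , b , R) → length l ≤ wl → length r ≤ wr →
    grow rule border pad (display (frame (config q l s r) wl wr) ++ clocks m)
      ≡ display (frame (config q′ (b ∷ l) (nearest r) (farther r)) (2 + wl) wr) ++ clocks (suc m)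
  grow-moving-right q l s r wl wr m {q′} {b} δ≡ l≤ r≤ = begin
    grow rule border pad ((cells Lc ++ H ∷ cells (rightCells wr r)) ++ clocks m)
      ≡⟨ grow-around-head Lc q s (rightCells wr r) m δ≡ ⟩
    leftImage Lc H ++ cell b ∷ rightImage H (rightCells wr r) m
      ≡⟨ cong₂ (λ X Y → X ++ cell b ∷ Y) (left-stays H Lc (cong leftward δ≡))
                                         (right-moves H q′ wr r m (cong rightward δ≡) refl r≤) ⟩
    cells (blank ∷ Lc) ++ cell b ∷ H′ ∷ cells Rc′ ++ clocks (suc m)
      ≡⟨ cells-snoc (blank ∷ Lc) b _ ⟨
    cells ((blank ∷ Lc) ∷ʳ b) ++ H′ ∷ cells Rc′ ++ clocks (suc m)
      ≡⟨ cong (λ xs → cells (xs ∷ʳ b) ++ H′ ∷ cells Rc′ ++ clocks (suc m)) (leftCells-pad wl l l≤) ⟨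
    cells (leftCells (2 + wl) (b ∷ l)) ++ H′ ∷ cells Rc′ ++ clocks (suc m)
      ≡⟨ ++-assoc (cells (leftCells (2 + wl) (b ∷ l))) (H′ ∷ cells Rc′) (clocks (suc m)) ⟨
    display (frame (config q′ (b ∷ l) (nearest r) (farther r)) (2 + wl) wr) ++ clocks (suc m) ∎
    where
      open ≡-Reasoning
      H = head q s
      H′ = head q′ (nearest r)
      Lc = leftCells wl l
      Rc′ = rightCells wr (farther r)

  grow-moving-left : ∀ q l s r wl wr m {q′ b} → δM q s ≡ just (q′ , b , L) → length l ≤ wl → length r ≤ wr →
    grow rule border pad (display (frame (config q l s r) wl wr) ++ clocks m)
      ≡ display (frame (config q′ (farther l) (nearest l) (b ∷ r)) wl (2 + wr)) ++ clocks (suc m)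
  grow-moving-left q l s r wl wr m {q′} {b} δ≡ l≤ r≤ = begin
    grow rule border pad ((cells (leftCells wl l) ++ H ∷ cells Rc) ++ clocks m)
      ≡⟨ grow-around-head (leftCells wl l) q s Rc m δ≡ ⟩
    leftImage (leftCells wl l) H ++ cell b ∷ rightImage H Rc m
      ≡⟨ cong₂ (λ X Y → X ++ cell b ∷ Y) (left-moves H q′ wl l (cong leftward δ≡) l≤)
                                         (right-stays H Rc m (cong rightward δ≡) refl) ⟩
    (cells Lc′ ∷ʳ H′) ++ cell b ∷ cells (Rc ∷ʳ blank) ++ clocks (suc m)
      ≡⟨ ∷ʳ-++ (cells Lc′) H′ _ ⟩
    cells Lc′ ++ H′ ∷ cells (b ∷ Rc ∷ʳ blank) ++ clocks (suc m)
      ≡⟨ cong (λ xs → cells Lc′ ++ H′ ∷ cells (b ∷ xs) ++ clocks (suc m)) (rightCells-pad wr r r≤) ⟨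
    cells Lc′ ++ H′ ∷ cells (rightCells (2 + wr) (b ∷ r)) ++ clocks (suc m)
      ≡⟨ ++-assoc (cells Lc′) (H′ ∷ cells (rightCells (2 + wr) (b ∷ r))) (clocks (suc m)) ⟨
    display (frame (config q′ (farther l) (nearest l) (b ∷ r)) wl (2 + wr)) ++ clocks (suc m) ∎
    where
      open ≡-Reasoning
      H = head q s
      H′ = head q′ (nearest l)
      Rc = rightCells wr r
      Lc′ = leftCells wl (farther l)

  grow-display : ∀ f f′ m → Fits f → advance f ≡ just f′ →
    grow rule border pad (display f ++ clocks m) ≡ display f′ ++ clocks (suc m)
  grow-display (frame (config q l s r) wl wr) f′ m (l≤ , r≤) eq with δM q s in δ≡
  grow-display _ _ m _ () | nothing
  grow-display (frame (config q l s r) wl wr) _ m (l≤ , r≤) refl | just (_ , _ , R) =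
    grow-moving-right q l s r wl wr m δ≡ l≤ r≤
  grow-display (frame (config q l s r) wl wr) _ m (l≤ , r≤) refl | just (_ , _ , L) =
    grow-moving-left q l s r wl wr m δ≡ l≤ r≤

  grow-display-halts : ∀ f m → advance f ≡ nothing → halted ∈ grow rule border pad (display f ++ clocks m)
  grow-display-halts (frame (config q l s r) wl wr) m eq with δM q s in δ≡
  grow-display-halts (frame (config q l s r) wl wr) m eq | nothing =
    subst (halted ∈_) (sym (grow-around-head (leftCells wl l) q s (rightCells wr r) m δ≡))
      (∈-++⁺ʳ (leftImage (leftCells wl l) (head q s)) (here refl))
  grow-display-halts _ _ () | just (_ , _ , R)
  grow-display-halts _ _ () | just (_ , _ , L)

  map-decode-encode : ∀ xs → map decode (map encode xs) ≡ xs
  map-decode-encode []       = refl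
  map-decode-encode (x ∷ xs) = cong₂ _∷_ (decode-encode x) (map-decode-encode xs)

  evolve-encode : ∀ xs → evolve (map encode xs) ≡ map encode (grow rule border pad xs)
  evolve-encode xs = trans (evolve-decode (map encode xs)) (cong (map encode ∘ grow rule border pad) (map-decode-encode xs))

  evolve-word : ∀ f f′ m → Fits f → advance f ≡ just f′ → evolve (word f m) ≡ word f′ (suc m)
  evolve-word f f′ m fits eq = trans (evolve-encode _) (cong (map encode) (grow-display f f′ m fits eq))

  running-encode : ∀ c → isHalted c ≡ false → T (running (encode c))
  running-encode c c-ok rewrite decode-encode c | c-ok = tt

  encode-running : ∀ xs → All (λ c → isHalted c ≡ false) xs → All (T ∘ running) (map encode xs)
  encode-running xs ok = map⁺ (All.map (running-encode _) ok)

  Dom-word : ∀ f m → Dom (word f m)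
  Dom-word (frame (config q l s r) wl wr) m = Equivalence.from (accepts-domain _) (encode-running _
    (++⁺ (++⁺ (cells-ok (leftCells wl l)) (refl ∷ cells-ok (rightCells wr r))) (replicate⁺ m refl)))
    where
      cells-ok : ∀ cs → All (λ c → isHalted c ≡ false) (cells cs)
      cells-ok cs = map⁺ (All.universal (λ _ → refl) cs)

  ¬Dom-evolve-halted : ∀ f m → advance f ≡ nothing → ¬ Dom (evolve (word f m))
  ¬Dom-evolve-halted f m halts dom =
    subst (T ∘ not ∘ isHalted) (decode-encode halted)
      (All.lookup (Equivalence.to (accepts-domain _) (subst Dom (evolve-encode (display f ++ clocks m)) dom))
                  (∈-map⁺ encode (grow-display-halts f m halts)))

  evolveⁿ : ℕ → W → W
  evolveⁿ zero    u = u
  evolveⁿ (suc n) u = evolveⁿ n (evolve u)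

  private
    advanceⁿ-suc : ∀ i f g → advanceⁿ (suc i) f ≡ just g →
                   ∃[ f′ ] (advance f ≡ just f′ × advanceⁿ i f′ ≡ just g)
    advanceⁿ-suc i f g eq with advance f
    ... | just f′ = f′ , refl , eq

  evolveⁿ-word : ∀ i f g m → Fits f → advanceⁿ i f ≡ just g → evolveⁿ i (word f m) ≡ word g (i + m)
  evolveⁿ-word zero    f .f m _    refl = refl
  evolveⁿ-word (suc i) f g  m fits eq with advanceⁿ-suc i f g eq
  ... | f′ , step≡ , rest = begin
    evolveⁿ i (evolve (word f m)) ≡⟨ cong (evolveⁿ i) (evolve-word f f′ m fits step≡) ⟩
    evolveⁿ i (word f′ (suc m))   ≡⟨ evolveⁿ-word i f′ g (suc m) (advance-fits f f′ fits step≡) rest ⟩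
    word g (i + suc m)            ≡⟨ cong (word g) (+-suc i m) ⟩
    word g (suc i + m)            ∎
    where open ≡-Reasoning

  evolution-connected : ∀ i f g m → Fits f → advanceⁿ i f ≡ just g → EqClosure Edge (word f m) (word g (i + m))
  evolution-connected zero    f .f m _    refl = ε
  evolution-connected (suc i) f g  m fits eq with advanceⁿ-suc i f g eq
  ... | f′ , step≡ , rest =
    fwd (edge-evolve (word f m) (word f′ (suc m)) (Dom-word f m) (Dom-word f′ (suc m)) (sym (evolve-word f f′ m fits step≡)))
    ◅ subst (EqClosure Edge (word f′ (suc m)) ∘ word g) (+-suc i m)
            (evolution-connected i f′ g (suc m) (advance-fits f f′ fits step≡) rest)

  NoClockAtEnd : List Letter → Set
  NoClockAtEnd []          = ⊤
  NoClockAtEnd (c ∷ [])    = isClockLike c ≡ false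
  NoClockAtEnd (_ ∷ d ∷ x) = NoClockAtEnd (d ∷ x)

  private
    consTrailing : Letter → ℕ × List Letter → ℕ × List Letter
    consTrailing c (m , [])    = if isClockLike c then (suc m , []) else (m , c ∷ [])
    consTrailing c (m , d ∷ x) = m , c ∷ d ∷ x

  -- trailing u = (m , x) splits u into x and a maximal clock-like suffix of length m.
  trailing : List Letter → ℕ × List Letter
  trailing []      = 0 , []
  trailing (c ∷ u) = consTrailing c (trailing u)

  trailing-++ : ∀ x as → NoClockAtEnd x → AllClockLike as → trailing (x ++ as) ≡ (length as , x)
  trailing-++ []          []       _   []                 = refl
  trailing-++ []          (a ∷ as) _   (a-clock ∷ as-clock) rewrite trailing-++ [] as tt as-clock | a-clock = refl
  trailing-++ (c ∷ [])    as       c-end as-clock rewrite trailing-++ [] as tt as-clock | c-end = refl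
  trailing-++ (c ∷ d ∷ x) as       end   as-clock rewrite trailing-++ (d ∷ x) as end as-clock = refl

  trailing-split : ∀ u → ∃[ as ] (u ≡ proj₂ (trailing u) ++ as × AllClockLike as × length as ≡ proj₁ (trailing u)
                                  × NoClockAtEnd (proj₂ (trailing u)))
  trailing-split []      = [] , refl , [] , refl , tt
  trailing-split (c ∷ u) with trailing u | trailing-split u
  ... | m , d ∷ x | as , refl , as-clock , refl , end = as , refl , as-clock , refl , end
  ... | m , []    | as , refl , as-clock , refl , _ with isClockLike c in c-clock
  ...   | true  = c ∷ as , refl , c-clock ∷ as-clock , refl , tt
  ...   | false = as , refl , as-clock , refl , c-clock

  private
    NoClockAtEnd-∷ʳ : ∀ xs c → isClockLike c ≡ false → NoClockAtEnd (xs ∷ʳ c)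
    NoClockAtEnd-∷ʳ []          c c-tape = c-tape
    NoClockAtEnd-∷ʳ (_ ∷ [])    c c-tape = c-tape
    NoClockAtEnd-∷ʳ (_ ∷ d ∷ x) c c-tape = NoClockAtEnd-∷ʳ (d ∷ x) c c-tape

    lastOr-noClockAtEnd : ∀ l c x → NoClockAtEnd (c ∷ x) → isClockLike (lastOr l (c ∷ x)) ≡ false
    lastOr-noClockAtEnd l c []      end = end
    lastOr-noClockAtEnd l c (d ∷ x) end = lastOr-noClockAtEnd c d x end

    lastOr-border : ∀ x → NoClockAtEnd x → isClockLike (lastOr border x) ≡ false
    lastOr-border []      _   = refl
    lastOr-border (c ∷ x) end = lastOr-noClockAtEnd border c x end

    enter-tape : ∀ m s → isClockLike (enter m s) ≡ false
    enter-tape (just _) s = refl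
    enter-tape nothing  s = refl

  grow-noClockAtEnd : ∀ x as → NoClockAtEnd x → AllClockLike as →
    ∃[ x′ ] (grow rule border pad (x ++ as) ≡ x′ ++ clocks (suc (length as))
             × NoClockAtEnd x′ × length x′ ≡ 2 + length x)
  grow-noClockAtEnd x as end as-clock =
    S ∷ʳ e , grow≡ , NoClockAtEnd-∷ʳ S e (enter-tape _ blank) , length≡
    where
      open ≡-Reasoning
      l = lastOr border x
      S = sweep rule border (border ∷ x) (firstOr (as ++ tape-end) pad)
      e = enter (fromLeft l) blank
      grow≡ : grow rule border pad (x ++ as) ≡ (S ∷ʳ e) ++ clocks (suc (length as))
      grow≡ = begin
        sweep rule border (border ∷ (x ++ as) ++ tape-end) pad
          ≡⟨ cong (λ v → sweep rule border (border ∷ v) pad) (++-assoc x as tape-end) ⟩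
        sweep rule border ((border ∷ x) ++ as ++ tape-end) pad
          ≡⟨ sweep-++ rule border (border ∷ x) (as ++ tape-end) pad ⟩
        S ++ sweep rule l (as ++ tape-end) pad
          ≡⟨ cong (S ++_) (sweep-tape-end l as (lastOr-border x end) as-clock) ⟩
        S ++ e ∷ clocks (suc (length as))
          ≡⟨ ∷ʳ-++ S e _ ⟨
        (S ∷ʳ e) ++ clocks (suc (length as)) ∎
      length≡ : length (S ∷ʳ e) ≡ 2 + length x
      length≡ = begin
        length (S ∷ʳ e)   ≡⟨ length-++ S ⟩
        length S + 1      ≡⟨ cong (_+ 1) (length-sweep rule border (border ∷ x) _) ⟩
        suc (length x) + 1 ≡⟨ +-comm (suc (length x)) 1 ⟩
        2 + length x      ∎

  trailing-grow : ∀ u → ∃[ x′ ] (trailing (grow rule border pad u) ≡ (suc (proj₁ (trailing u)) , x′)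
                                 × length x′ ≡ 2 + length (proj₂ (trailing u)))
  trailing-grow u with trailing-split u
  ... | as , u≡ , as-clock , |as|≡m , end with grow-noClockAtEnd (proj₂ (trailing u)) as end as-clock
  ...   | x′ , grow≡ , end′ , |x′|≡ = x′ , trailing≡ , |x′|≡
    where
      trailing≡ : trailing (grow rule border pad u) ≡ (suc (proj₁ (trailing u)) , x′)
      trailing≡ = begin
        trailing (grow rule border pad u)                ≡⟨ cong (trailing ∘ grow rule border pad) u≡ ⟩
        trailing (grow rule border pad (proj₂ (trailing u) ++ as)) ≡⟨ cong trailing grow≡ ⟩
        trailing (x′ ++ clocks (suc (length as)))        ≡⟨ trailing-++ x′ _ end′ (replicate⁺ _ refl) ⟩
        (length (clocks (suc (length as))) , x′)         ≡⟨ cong (λ n → suc n , x′) (trans (length-replicate (length as)) |as|≡m) ⟩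
        (suc (proj₁ (trailing u)) , x′)                  ∎
        where open ≡-Reasoning

  decode-evolve : ∀ u → map decode (evolve u) ≡ grow rule border pad (map decode u)
  decode-evolve u = trans (cong (map decode) (evolve-decode u)) (map-decode-encode _)

  f₀ : Frame
  f₀ = frame (initial M) 0 0

  word₀ : ∀ m → word f₀ m ≡ start₀ ∷ replicate m clock₀
  word₀ m = cong (start₀ ∷_) (map-replicate encode m clock)

  trailing-word₀ : ∀ m → trailing (map decode (word f₀ m)) ≡ (m , head zero blank ∷ [])
  trailing-word₀ m = begin
    trailing (map decode (word f₀ m))         ≡⟨ cong trailing (map-decode-encode (head zero blank ∷ clocks m)) ⟩
    trailing (head zero blank ∷ clocks m)     ≡⟨ trailing-++ (head zero blank ∷ []) (clocks m) refl (replicate⁺ m refl) ⟩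
    (length (clocks m) , head zero blank ∷ []) ≡⟨ cong (_, head zero blank ∷ []) (length-replicate m) ⟩
    (m , head zero blank ∷ [])         ∎
    where open ≡-Reasoning

  instance₀ : Instance
  instance₀ = record { k = K ; G = graph ; s = word f₀ 0 ; t = word f₀ 1 ; s∈ = Dom-word f₀ 0 ; t∈ = Dom-word f₀ 1 }

  -- A word with m trailing clocks is on the side of s when it has the shape of a word reached after m
  -- steps and reaches the halting word after the remaining h - m steps.
  module Separation (h : ℕ) (g : Frame) (reach : advanceⁿ h f₀ ≡ just g) (stuck : advance g ≡ nothing) where

    SeparatedAt : W → ℕ × List Letter → Set
    SeparatedAt u (m , x) = Dom u × length x ≡ suc (m + m) × m ≤ h × evolveⁿ (h ∸ m) u ≡ word g h

    Separated : W → Set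
    Separated u = SeparatedAt u (trailing (map decode u))

    separated? : ∀ u → Dec (Separated u)
    separated? u with trailing (map decode u)
    ... | m , x = T? _ ×-dec length x ℕ.≟ suc (m + m) ×-dec m ≤? h ×-dec ≡-dec _≟_ (evolveⁿ (h ∸ m) u) (word g h)

    separated-short : ∀ u → Separated u → length u ≤ suc (h + h) + h
    separated-short u sep with trailing-split (map decode u)
    ... | as , u≡ , _ , |as|≡m , _ with trailing (map decode u) | sep
    ...   | m , x | _ , |x|≡ , m≤h , _ = begin
      length u                   ≡⟨ length-map decode u ⟨
      length (map decode u)      ≡⟨ cong length u≡ ⟩
      length (x ++ as)           ≡⟨ length-++ x ⟩
      length x + length as       ≡⟨ cong₂ _+_ |x|≡ |as|≡m ⟩
      suc (m + m) + m            ≤⟨ +-mono-≤ (s≤s (+-mono-≤ m≤h m≤h)) m≤h ⟩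
      suc (h + h) + h            ∎
      where open ≤-Reasoning

    private
      target-halts : ∀ u → evolveⁿ (h ∸ h) u ≡ word g h → ¬ Dom (evolve u)
      target-halts u reach-u rewrite n∸n≡0 h | reach-u = ¬Dom-evolve-halted g h stuck

    separated-evolve : ∀ u → Dom u → Dom (evolve u) → Separated u ⇔ Separated (evolve u)
    separated-evolve u du dv with trailing-grow (map decode u)
    ... | x′ , trailing≡ , |x′|≡ =
      ⇔-trans (mk⇔ forward backward) (≡⇒⇔ (cong (SeparatedAt (evolve u)) (sym trailing-evolve)))
      where
        m = proj₁ (trailing (map decode u))
        x = proj₂ (trailing (map decode u))

        trailing-evolve : trailing (map decode (evolve u)) ≡ (suc m , x′)
        trailing-evolve = trans (cong trailing (decode-evolve u)) trailing≡

        forward : SeparatedAt u (m , x) → SeparatedAt (evolve u) (suc m , x′)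
        forward (_ , |x|≡ , m≤h , reach-u) = dv , |x′|≡′ , m<h , trans (cong (λ n → evolveⁿ n u) (sym h∸m≡)) reach-u
          where
            |x′|≡′ : length x′ ≡ suc (suc m + suc m)
            |x′|≡′ = trans |x′|≡ (cong (2 +_) (trans |x|≡ (sym (+-suc m m))))
            m<h : m < h
            m<h = ≤∧≢⇒< m≤h (λ { refl → target-halts u reach-u dv })
            h∸m≡ : h ∸ m ≡ suc (h ∸ suc m)
            h∸m≡ = +-∸-assoc 1 m<h

        backward : SeparatedAt (evolve u) (suc m , x′) → SeparatedAt u (m , x)
        backward (_ , |x′|≡′ , m<h , reach-v) =
          du , |x|≡ , <⇒≤ m<h , trans (cong (λ n → evolveⁿ n u) (+-∸-assoc 1 m<h)) reach-v
          where
            |x|≡ : length x ≡ suc (m + m)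
            |x|≡ = suc-injective (suc-injective (trans (sym |x′|≡) (trans |x′|≡′ (cong (2 +_) (+-suc m m)))))

    ¬separated-word₀ : ∀ d → ¬ Separated (word f₀ (suc d))
    ¬separated-word₀ d rewrite trailing-word₀ (suc d) = λ ()

    open BoundedLanguage (suc (h + h) + h) separated? separated-short

    private
      separated-s : Separated (word f₀ 0)
      separated-s rewrite trailing-word₀ 0 =
        Dom-word f₀ 0 , refl , z≤n , trans (evolveⁿ-word h f₀ g 0 (z≤n , z≤n) reach) (cong (word g) (+-identityʳ h))

      rejects-ladder : ∀ d → ¬ accepts boundedDFA (start₀ ∷ replicate (suc d) clock₀)
      rejects-ladder d acc =
        ¬separated-word₀ d (subst Separated (sym (word₀ (suc d)))
                               (Equivalence.to (accepts-boundedDFA (start₀ ∷ replicate (suc d) clock₀)) acc))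

    separator-closed : UnionOfComponents graph boundedDFA
    separator-closed = (λ w acc → proj₁ (Equivalence.to (accepts-boundedDFA w) acc)) , closed
      where
        closed : ∀ u v → Edge u v → accepts boundedDFA u ⇔ accepts boundedDFA v
        closed u v (du , dv , e) with Equivalence.to (accepts-edge u v) e
        ... | inj₁ refl = ⇔-trans (accepts-boundedDFA u) (⇔-trans (separated-evolve u du dv) (⇔-sym (accepts-boundedDFA v)))
        ... | inj₂ (d , refl , refl) = mk⇔ (⊥-elim ∘ rejects-ladder d) (⊥-elim ∘ rejects-ladder (suc d))

    separable : RegUnconn instance₀
    separable = boundedDFA , Equivalence.from (accepts-boundedDFA (word f₀ 0)) separated-s
              , ¬separated-word₀ 0 ∘ Equivalence.to (accepts-boundedDFA (word f₀ 1)) , separator-closed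

  ladder-connected : ∀ d → EqClosure Edge (word f₀ 1) (word f₀ (suc d))
  ladder-connected zero    = ε
  ladder-connected (suc d) =
    ladder-connected d ◅◅ fwd (edge-ladder (word f₀ (suc d)) (word f₀ (suc (suc d)))
                                           (Dom-word f₀ (suc d)) (Dom-word f₀ (suc (suc d)))
                                           (d , word₀ (suc d) , word₀ (suc (suc d)))) ◅ ε

  module Inseparable (D : DFA (Fin K)) (s∈D : accepts D (word f₀ 0)) (closed : UnionOfComponents graph D) where

    N : ℕ
    N = suc (DFA.n D)

    accepts-ladder : ∀ g → advanceⁿ N f₀ ≡ just g → accepts D (word f₀ 1)
    accepts-ladder g reach with pumping D clock₀ (map encode (display g))
    ... | d , same-run =
      back (ladder-connected d) (back (evolution-connected N f₀ g (suc d) (z≤n , z≤n) reach) pumped)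
      where
        back : ∀ {u v} → EqClosure Edge u v → accepts D v → accepts D u
        back u~v = Equivalence.from (accepts-componentwise graph D closed u~v)

        word≡ : ∀ j → word g j ≡ map encode (display g) ++ replicate j clock₀
        word≡ j = trans (map-++ encode (display g) (clocks j)) (cong (map encode (display g) ++_) (map-replicate encode j clock))

        reached : accepts D (word g N)
        reached = subst (accepts D ∘ word g) (+-identityʳ N)
                    (Equivalence.to (accepts-componentwise graph D closed (evolution-connected N f₀ g 0 (z≤n , z≤n) reach))
                                    s∈D)

        pumped : accepts D (word g (N + suc d))
        pumped = subst (accepts D) (sym (word≡ (N + suc d))) pumped′
          where
            reached′ : accepts D (map encode (display g) ++ replicate N clock₀)
            reached′ = subst (accepts D) (word≡ N) reached
            pumped′ : accepts D (map encode (display g) ++ replicate (N + suc d) clock₀)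
            pumped′ = subst (T ∘ DFA.final D) same-run reached′

    halts : ¬ accepts D (word f₀ 1) → Halts M
    halts t∉D with advanceⁿ N f₀ in eq
    ... | nothing = N , trans (iterate-advanceⁿ N f₀) (cong (mapᴹ Frame.cfg) eq)
    ... | just g  = ⊥-elim (t∉D (accepts-ladder g eq))

  first-stuck : ∀ n f → advanceⁿ n f ≡ nothing → ∃[ h ] ∃[ g ] (advanceⁿ h f ≡ just g × advance g ≡ nothing)
  first-stuck (suc n) f stuck with advance f in eq
  ... | nothing = 0 , f , refl , eq
  ... | just f′ with first-stuck n f′ stuck
  ...   | h , g , reach , g-stuck = suc h , g , subst (λ m → (m >>= advanceⁿ h) ≡ just g) (sym eq) reach , g-stuck

  halted⇒stuck : ∀ n → iterate M n (initial M) ≡ nothing → advanceⁿ n f₀ ≡ nothing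
  halted⇒stuck n halted-n with advanceⁿ n f₀ | iterate-advanceⁿ n f₀
  ... | nothing | _  = refl
  ... | just _  | it with trans (sym halted-n) it
  ...   | ()

  halts→separable : Halts M → RegUnconn instance₀
  halts→separable (n , halted-n) with first-stuck n f₀ (halted⇒stuck n halted-n)
  ... | h , g , reach , stuck = Separation.separable h g reach stuck

  separable→halts : RegUnconn instance₀ → Halts M
  separable→halts (D , s∈D , t∉D , closed) = Inseparable.halts D s∈D closed t∉D

lemma31 : Σ (TM → Instance) λ f → (M : TM) → Halts M ⇔ RegUnconn (f M)
lemma31 = Reduction.instance₀ , λ M → mk⇔ (Reduction.halts→separable M) (Reduction.separable→halts M)
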